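{- Let $\psi$ be either $\psi_\omega$ or $\psi_2$ (the Fraïssé limit of finite pseudotrees, respectively of finite binary pseudotrees), let $f$ be an enumerating function for $\psi$, and let $\mathrm{os}$ be the function on pairs of incomparable elements of $\psi$ derived from $f$ as defined in the context. Let $\varphi \in \binom{\psi}{\psi}$. Then for every integer $\ell \geq 1$ there are incomparable $a, b \in \varphi$ such that $\mathrm{os}(a,b) = \ell$. In particular, $\mathrm d(\psi_2 : \mathrm A) = \mathrm d(\psi_\omega : \mathrm A) = \infty$, where $\mathrm A$ is the three element pseudotree consisting of a root and two incomparable nodes.
   Context: A pseudotree is a structure $T$ with a (reflexive, antisymmetric, transitive) order relation $\leq$ and a binary function $\wedge$ such that $\sup\{x \in T : x \leq a,\ x \leq b\} = a \wedge b$ for all $a,b \in T$ (in particular this supremum exists), and such that for each $a \in T$ the set $D_T(a) = \{x \in T : x \leq a\}$ is linearly ordered by $\leq$. A pseudotree $T$ is binary if for every $a \in T$ and $x,y,z > a$ it is not the case that $a = x\wedge y = x \wedge z = y \wedge z$. Finite pseudotrees, and finite binary pseudotrees, with embeddings respecting $\leq$ and $\wedge$, form Fraïssé classes; their Fraïssé limits are $\psi_\omega$ and $\psi_2$ respectively. The symbol $\psi$ also denotes the domain of the structure. For structures $A, B$, $\binom{B}{A}$ is the set of all substructures of $B$ isomorphic to $A$. A natural number $\ell$ is identified with $\{0,\dots,\ell-1\}$, and $g[x]$ denotes the image of the set $x$ under the function $g$. For $\ell \in \omega$ write $B \to (B)^A_\ell$ if for every function $c\colon \binom{B}{A} \to \ell$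 there exists $C \in \binom{B}{B}$ such that $c\left[\binom{C}{A}\right] \neq \ell$ (i.e. some color is omitted). The big Ramsey degree $\mathrm d(B : A)$ of $A$ in $B$ is the smallest $\ell\in\omega$ for which $B \to (B)^A_{\ell+1}$, and $\mathrm d(B:A) = \infty$ if no such $\ell$ exists. A set $R \subset \psi$ is a ray in $\psi$ if either (i) $\inf R$ exists in $\psi$, denoted $o(R)$, and then $o(R)\notin R$ and $R$ is a $\subseteq$-maximal linearly ordered subset of $\psi$ with infimum $o(R)$ (maximal among those not containing $o(R)$); or (ii) $\inf R$ does not exist and $R$ is a $\subseteq$-maximal linearly ordered subset of $\psi$. The set of all rays is $\overline{\mathcal R}$. An enumerating function is a one-to-one function $f\colon \omega \to \psi \cup \overline{\mathcal R}$ such that: (1) $\psi \cap f[n]$ is a pseudotree (a substructure of $\psi$) for each $n \in \omega$; (2) $\psi \subset f[\omega]$; (3) if $f(n) = R \in \overline{\mathcal R}$ and $o(R)$ is defined, then $o(R) \in f[n] \cap \psi$; (4) if $f(n) \in \psi$, then $f(n) \in \bigcup (f[n] \cap \overline{\mathcal R})$; (5) if $n \neq m$ and $f(n), f(m) \in \overline{\mathcal R}$, then $f(n) \cap f(m) = \emptyset$. Such a function exists. Put $\mathcal R = f[\omega] \cap \overline{\mathcal R}$, and let $e\colon \psi \cup \mathcal R \to \omega$ be the bijection inverse to $f$. For $a \in \psi$ let $P(a) = \{R \in \mathcal R : R \cap D_\psi(a) \neq \emptyset\}$ and $p(a) = \{e(R) : R \in P(a)\}$, which is a finite subset of $\omega$.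 For disjoint finite sets $u_0, u_1 \subset \omega$ let $\simeq$ be the equivalence relation on $u_0 \cup u_1$ defined by $n \simeq m$ if there is $i \in \{0,1\}$ such that $m, n \in u_i$ and there is no $k \in u_{1-i}$ such that $n<k<m$ or $m<k<n$. Let $\mathrm{osc}(u_0,u_1)$ be the number of equivalence classes of $\simeq$. For incomparable $a, b \in \psi$ define $\mathrm{os}(a,b) = \mathrm{osc}(p(a) \setminus p(b),\, p(b) \setminus p(a))$. -}

module Defs where

open import Level using (0ℓ) renaming (suc to lsuc)
open import Data.Bool using (Bool; true; false; not; if_then_else_)
open import Data.Empty using (⊥; ⊥-elim)
open import Data.Fin using (Fin)
open import Data.Nat using (ℕ; suc; _<_)
open import Data.Nat.Properties using (<-asym; <-cmp)
open import Data.Product using (Σ; Σ-syntax; ∃-syntax; _×_; _,_; proj₁; proj₂)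
open import Data.Sum using (_⊎_; inj₁; inj₂; [_,_]′)
open import Data.Sum.Relation.Binary.Pointwise using (Pointwise)
open import Function using (_on_)
open import Function.Bundles using (_⇔_; _↔_; _↣_; Func; Bijection)
open import Relation.Binary using (Rel; Setoid; IsPartialOrder; tri<; tri≈; tri>)
import Relation.Binary.Construct.On as On
open import Relation.Binary.PropositionalEquality
  using (_≡_; _≢_; refl; setoid)
open import Relation.Nullary using (¬_)
open import Relation.Unary using (Pred; _∈_; _∉_; _⊆_; _≐_; _∪_; _∖_; _≬_)
  renaming (_⊥_ to _IsDisjointFrom_)
open import Relation.Unary.Relation.Binary.Equality using (≐-setoid)

record Structure : Set₁ where
  infix 4 _≤_
  infixr 7 _∧_
  field
    Carrier : Set
    _≤_     : Rel Carrier 0ℓ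
    _∧_     : Carrier → Carrier → Carrier

module _ (T : Structure) where
  open Structure T

  Below : Carrier → Pred Carrier 0ℓ
  Below a x = x ≤ a

  _<ₜ_ : Rel Carrier 0ℓ
  a <ₜ x = a ≤ x × a ≢ x

  Incomparable : Rel Carrier 0ℓ
  Incomparable a b = ¬ (a ≤ b) × ¬ (b ≤ a)

  IsSup : Pred Carrier 0ℓ → Pred Carrier 0ℓ
  IsSup X s = (∀ {x} → x ∈ X → x ≤ s)
            × (∀ {u} → (∀ {x} → x ∈ X → x ≤ u) → s ≤ u)

  IsInf : Pred Carrier 0ℓ → Pred Carrier 0ℓ
  IsInf X o = (∀ {x} → x ∈ X → o ≤ x)
            × (∀ {l} → (∀ {x} → x ∈ X → l ≤ x) → l ≤ o)

  Linear : Pred (Pred Carrier 0ℓ) 0ℓ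
  Linear X = ∀ {x y} → x ∈ X → y ∈ X → x ≤ y ⊎ y ≤ x

  Closed : ∀ {ℓ} → Pred (Pred Carrier ℓ) ℓ
  Closed X = ∀ {x y} → x ∈ X → y ∈ X → (x ∧ y) ∈ X

  data Generated {n : ℕ} (g : Fin n → Carrier) : Pred Carrier 0ℓ where
    gen  : ∀ i → Generated g (g i)
    meet : ∀ {x y} → Generated g x → Generated g y → Generated g (x ∧ y)

  FinitelyGenerated : Set
  FinitelyGenerated =
    ∃[ n ] Σ[ g ∈ (Fin n → Carrier) ] ∀ x → Generated g x

  record IsPseudotree : Set where
    field
      isPartialOrder : IsPartialOrder _≡_ _≤_
      ∧-sup          : ∀ a b → IsSup (λ x → x ≤ a × x ≤ b) (a ∧ b)
      below-linear   : ∀ a → Linear (Below a)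

  IsBinary : Set
  IsBinary = ∀ a x y z → a <ₜ x → a <ₜ y → a <ₜ z →
             ¬ (a ≡ x ∧ y × a ≡ x ∧ z × a ≡ y ∧ z)

  IsFinite : Set
  IsFinite = ∃[ n ] (Carrier ↔ Fin n)

FinitePseudotree : Pred Structure 0ℓ
FinitePseudotree T = IsFinite T × IsPseudotree T

FiniteBinaryPseudotree : Pred Structure 0ℓ
FiniteBinaryPseudotree T = FinitePseudotree T × IsBinary T

open Structure using (Carrier)

record _↪_ (A B : Structure) : Set where
  private
    module A = Structure A
    module B = Structure B
  field
    to        : A.Carrier → B.Carrier
    injective : ∀ {x y} → to x ≡ to y → x ≡ y
    ≤-iff     : ∀ {x y} → x A.≤ y ⇔ to x B.≤ to y
    ∧-hom     : ∀ x y → to (x A.∧ y) ≡ to x B.∧ to y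

Automorphism : Structure → Set
Automorphism A = Σ[ h ∈ A ↪ A ] ∀ y → ∃[ x ] _↪_.to h x ≡ y

-- A substructure of B (with the induced relation and operation)
-- isomorphic to A; the isomorphism is an embedding of A with image
-- exactly the given subset.
record Copy (B A : Structure) : Set₁ where
  field
    subset : Pred (Carrier B) 0ℓ
    closed : Closed B subset
    iso    : Σ[ h ∈ A ↪ B ] ∀ y → y ∈ subset ⇔ (∃[ x ] _↪_.to h x ≡ y)

open Copy using (subset)

-- The set (B choose A): copies are identified when they have the same
-- elements, irrespective of the witnessing isomorphism.
Binom : Structure → Structure → Setoid (lsuc 0ℓ) 0ℓ
Binom B A = On.setoid (≐-setoid (Carrier B) 0ℓ) (subset {B} {A})

record IsFraïsséLimit (K : Pred Structure 0ℓ) (M : Structure) : Set₁ where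
  field
    countable   : Carrier M ↣ ℕ
    age         : ∀ A → K A ⇔ (FinitelyGenerated A × (A ↪ M))
    -- Every isomorphism h ∘ g⁻¹ between finitely generated substructures
    -- extends to an automorphism.
    homogeneous : ∀ A → FinitelyGenerated A → (g h : A ↪ M) →
                  Σ[ α ∈ Automorphism M ]
                  ∀ x → _↪_.to (proj₁ α) (_↪_.to g x) ≡ _↪_.to h x

-- B → (B)^A_ℓ.  The elements of (C choose A) are the copies of A in B
-- that are contained in C.
Arrows : Structure → Structure → ℕ → Set₁
Arrows B A ℓ =
  (c : Func (Binom B A) (setoid (Fin ℓ))) →
  Σ[ C ∈ Copy B B ]
  ¬ (∀ i → Σ[ X ∈ Copy B A ] subset X ⊆ subset C × Func.to c X ≡ i)

data ℕ∞ : Set where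
  fin : ℕ → ℕ∞
  ∞   : ℕ∞

BigRamseyDegree : Structure → Structure → ℕ∞ → Set₁
BigRamseyDegree B A (fin ℓ) =
  Arrows B A (suc ℓ) × (∀ m → m < ℓ → ¬ Arrows B A (suc m))
BigRamseyDegree B A ∞       = ∀ ℓ → ¬ Arrows B A (suc ℓ)

data V : Set where
  root left right : V

data _≤ⱽ_ : Rel V 0ℓ where
  root≤ : ∀ {x} → root ≤ⱽ x
  ≤refl : ∀ {x} → x ≤ⱽ x

_∧ⱽ_ : V → V → V
left  ∧ⱽ left  = left
right ∧ⱽ right = right
_     ∧ⱽ _     = root

𝐀 : Structure
𝐀 = record { Carrier = V ; _≤_ = _≤ⱽ_ ; _∧_ = _∧ⱽ_ }

module _ (ψ : Structure) where
  open Structure ψ using (_≤_)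

  Maximal : Pred (Pred (Carrier ψ) 0ℓ) 0ℓ → Pred (Pred (Carrier ψ) 0ℓ) (lsuc 0ℓ)
  Maximal Q R = Q R × (∀ S → Q S → R ⊆ S → S ⊆ R)

  IsRay : Pred (Pred (Carrier ψ) 0ℓ) (lsuc 0ℓ)
  IsRay R =
      (∃[ o ] Maximal (λ S → Linear ψ S × IsInf ψ S o × o ∉ S) R)
    ⊎ (¬ (∃[ o ] IsInf ψ R o) × Maximal (Linear ψ) R)

  record Ray : Set₁ where
    field
      points : Pred (Carrier ψ) 0ℓ
      isRay  : IsRay points

  open Ray

  record EnumeratingFunction : Set₁ where
    field
      f : ℕ → Carrier ψ ⊎ Ray

    -- ψ ∩ f[n]
    PointsBefore : ℕ → Pred (Carrier ψ) (lsuc 0ℓ)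
    PointsBefore n x = ∃[ m ] m < n × f m ≡ inj₁ x

    field
      one-to-one   : ∀ {n m} → Pointwise _≡_ (_≐_ on points) (f n) (f m) → n ≡ m
      substructure : ∀ n → Closed ψ (PointsBefore n)
      covers       : ∀ x → ∃[ n ] f n ≡ inj₁ x
      ray-origin   : ∀ {n R o} → f n ≡ inj₂ R → IsInf ψ (points R) o →
                     o ∈ PointsBefore n
      point-on-ray : ∀ {n x} → f n ≡ inj₁ x →
                     ∃[ m ] m < n × (Σ[ R ∈ Ray ] f m ≡ inj₂ R × x ∈ points R)
      disjoint     : ∀ {n m R S} → n ≢ m → f n ≡ inj₂ R → f m ≡ inj₂ S →
                     (points R) IsDisjointFrom (points S)

    -- Since e is the inverse of f, a number n is of the form e(R) with
    -- R ∈ P(a) iff f(n) is a ray meeting Below a.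
    p : Carrier ψ → Pred ℕ 0ℓ
    p a n = [ (λ _ → ⊥) , (λ R → points R ≬ Below ψ a) ]′ (f n)

module Oscillation (u₀ u₁ : Pred ℕ 0ℓ) (u₀⊥u₁ : u₀ IsDisjointFrom u₁) where

  u : Bool → Pred ℕ 0ℓ
  u i = if i then u₁ else u₀

  infix 4 _≃_
  _≃_ : Rel ℕ 0ℓ
  n ≃ m = ∃[ i ] m ∈ u i × n ∈ u i ×
          ¬ (∃[ k ] k ∈ u (not i) × ((n < k × k < m) ⊎ (m < k × k < n)))

  u-disjoint : ∀ i {n} → n ∈ u i → ¬ (n ∈ u (not i))
  u-disjoint false p q = u₀⊥u₁ (p , q)
  u-disjoint true  p q = u₀⊥u₁ (q , p)

  ≃-refl : ∀ {n} → n ∈ u₀ ∪ u₁ → n ≃ n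
  ≃-refl (inj₁ p) = false , p , p , λ where
    (_ , _ , inj₁ (a , b)) → <-asym a b
    (_ , _ , inj₂ (a , b)) → <-asym a b
  ≃-refl (inj₂ p) = true , p , p , λ where
    (_ , _ , inj₁ (a , b)) → <-asym a b
    (_ , _ , inj₂ (a , b)) → <-asym a b

  ≃-sym : ∀ {n m} → n ≃ m → m ≃ n
  ≃-sym (i , p , q , h) = i , q , p , λ where
    (k , r , inj₁ s) → h (k , r , inj₂ s)
    (k , r , inj₂ s) → h (k , r , inj₁ s)

  private
    same-side : ∀ i {n m k} → m ∈ u i → n ∈ u i → k ∈ u i →
      ¬ (∃[ x ] x ∈ u (not i) × ((n < x × x < m) ⊎ (m < x × x < n))) →
      ¬ (∃[ x ] x ∈ u (not i) × ((m < x × x < k) ⊎ (k < x × x < m))) →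
      n ≃ k
    same-side i {n} {m} {k} pm pn pk h h′ = i , pk , pn , λ where
        (x , r , inj₁ (a , b)) → go₁ x r a b (<-cmp x m)
        (x , r , inj₂ (a , b)) → go₂ x r a b (<-cmp x m)
      where
      go₁ : ∀ x → x ∈ u (not i) → n < x → x < k → _ → ⊥
      go₁ x r a b (tri< l _ _)    = h (x , r , inj₁ (a , l))
      go₁ x r a b (tri≈ _ refl _) = u-disjoint i pm r
      go₁ x r a b (tri> _ _ g)    = h′ (x , r , inj₁ (g , b))
      go₂ : ∀ x → x ∈ u (not i) → k < x → x < n → _ → ⊥
      go₂ x r a b (tri< l _ _)    = h′ (x , r , inj₂ (a , l))
      go₂ x r a b (tri≈ _ refl _) = u-disjoint i pm r
      go₂ x r a b (tri> _ _ g)    = h (x , r , inj₂ (g , b))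

  ≃-trans : ∀ {n m k} → n ≃ m → m ≃ k → n ≃ k
  ≃-trans (false , pm , pn , h) (false , pk , _   , h′) = same-side false pm pn pk h h′
  ≃-trans (true  , pm , pn , h) (true  , pk , _   , h′) = same-side true pm pn pk h h′
  ≃-trans (false , pm , _  , _) (true  , _  , pm′ , _)  = ⊥-elim (u-disjoint false pm pm′)
  ≃-trans (true  , pm , _  , _) (false , _  , pm′ , _)  = ⊥-elim (u-disjoint true pm pm′)

  ≃-setoid : Setoid 0ℓ 0ℓ
  ≃-setoid = record
    { Carrier       = Σ ℕ (u₀ ∪ u₁)
    ; _≈_           = _≃_ on proj₁
    ; isEquivalence = record
      { refl  = λ {x} → ≃-refl (proj₂ x)
      ; sym   = ≃-sym
      ; trans = ≃-trans
      }
    }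

  -- osc(u₀ , u₁) = ℓ as a relation: a bijection from the quotient by ≃,
  -- presented as a setoid, onto Fin ℓ.
  HasOsc : ℕ → Set
  HasOsc ℓ = Bijection ≃-setoid (setoid (Fin ℓ))

-- HasOs F a b ℓ is os(a , b) = ℓ.
HasOs : {ψ : Structure} → EnumeratingFunction ψ → (a b : Carrier ψ) → ℕ → Set
HasOs F a b = Oscillation.HasOsc (p a ∖ p b) (p b ∖ p a)
                (λ (x , y) → proj₂ y (proj₁ x))
  where open EnumeratingFunction F

{-# OPTIONS --safe #-}

-- Label each point x by the index r x of its ray. Then r is monotone, points with equal labels are
-- comparable, and p(a) = { r z : z ≤ a }; nothing else about the enumerating function matters.
-- Below any point of a copy φ only finitely many labels occur, so φ contains a < x with r a = r x,
-- hence p(a) = p(x). Points of φ branching off from (a , x) at different places acquire disjoint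
-- sets of new labels, so one of them has all its new labels beyond any given bound. Extending a and b
-- alternately in this way adds exactly one class to the oscillation each time.
-- For the Ramsey degree, the least code of a point above x serves as r x just as well.

module Submission where

open import Defs
open import Axiom.ExcludedMiddle using (ExcludedMiddle)
open import Data.Bool using (true; false; not)
open import Data.Bool.Properties using (T-irrelevant)
open import Data.Fin using (Fin; toℕ; fromℕ; inject₁)
open import Data.Fin.Patterns using (0F; 1F; 2F; 3F)
open import Data.Fin.Properties as Fin using (all?; fromℕ≢inject₁; inject₁-injective)
open import Data.Fin.Relation.Unary.Top using (view; ‵fromℕ; ‵inject₁)
open import Data.Nat using (ℕ; zero; suc; _≤_; _<_; _≤?_; z≤n; s≤s)
open import Data.Nat.Induction using (<-wellFounded)
open import Data.Nat.Properties as ℕ using ()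
open import Data.Product using (Σ; Σ-syntax; ∃; ∃₂; ∃-syntax; _×_; _,_; proj₁; proj₂)
open import Data.Sum using (_⊎_; inj₁; inj₂; swap)
open import Data.Sum.Relation.Binary.Pointwise using (Pointwise; inj₁)
open import Function
  using (_∘_; _on_; id; _↣_; mk⇔; Equivalence; Injection; Surjection; Bijection; Func)
open import Function.Construct.Identity using (↔-id)
open import Induction.WellFounded using (Acc; acc)
open import Level using (0ℓ)
open import Relation.Binary using (IsPartialOrder)
import Relation.Binary.Construct.NonStrictToStrict as Strict
open import Relation.Binary.PropositionalEquality
  using (_≡_; _≢_; refl; sym; trans; cong; subst; subst₂; setoid; isEquivalence)
open import Relation.Nullary using (¬_; Dec; yes; no; contradiction)
open import Relation.Nullary.Decidable
  using (True; toWitness; fromWitness; from-yes; decidable-stable; ¬?; _→-dec_; _×-dec_; _⊎-dec_)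
open import Relation.Unary using (Pred; _∈_; _∉_; _⊆_; _∪_; _∖_; _≐_)
  renaming (_⊥_ to _IsDisjointFrom_)

open Structure using (Carrier)

least : ExcludedMiddle 0ℓ → (P : Pred ℕ 0ℓ) → ∀ {n} → n ∈ P →
  ∃[ m ] m ∈ P × (∀ {k} → k ∈ P → m ≤ k)
least lem P {n} = go (<-wellFounded n)
  where
  go : ∀ {n} → Acc _<_ n → n ∈ P → ∃[ m ] m ∈ P × (∀ {k} → k ∈ P → m ≤ k)
  go {n} (acc rs) pn with lem {∃[ k ] k < n × k ∈ P}
  ... | yes (k , k<n , pk) = go (rs k<n) pk
  ... | no none            = n , pn , λ {k} pk → ℕ.≮⇒≥ λ k<n → none (k , k<n , pk)

-- Oscillation

∖-disjoint : (A B : Pred ℕ 0ℓ) → (A ∖ B) IsDisjointFrom (B ∖ A)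
∖-disjoint A B (x , y) = proj₂ y (proj₁ x)

module _ {u₀ u₁ : Pred ℕ 0ℓ} (d : u₀ IsDisjointFrom u₁) where
  open Oscillation u₀ u₁ d using (HasOsc)

  -- A section of the first bijection followed by the second is injective. Used in both directions,
  -- this makes the oscillation number unique.
  HasOsc-≤ : ∀ {k l} → HasOsc k → HasOsc l → k ≤ l
  HasOsc-≤ B C = Fin.injective⇒≤ {f = C.to ∘ B.to⁻} λ {i} {j} eq →
    trans (sym (to∘to⁻ i)) (trans (B.cong (C.injective eq)) (to∘to⁻ j))
    where
    module B = Bijection B
    module C = Bijection C
    open Surjection B.surjection using (to∘to⁻)

  HasOsc-unique : ∀ {k l} → HasOsc k → HasOsc l → k ≡ l
  HasOsc-unique B C = ℕ.≤-antisym (HasOsc-≤ B C) (HasOsc-≤ C B)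

  -- With `u₀` empty, nothing can separate two elements of `u₁`.
  HasOsc-one : (∀ {n} → n ∉ u₀) → ∃ u₁ → HasOsc 1
  HasOsc-one empty (n , n∈u₁) = record
    { to        = λ _ → 0F
    ; cong      = λ _ → refl
    ; bijective = (λ { {_ , s} {_ , t} _ → true , one t , one s , λ (_ , k∈u₀ , _) → empty k∈u₀ })
                , (λ { 0F → (n , inj₂ n∈u₁) , λ _ → refl })
    }
    where
    one : ∀ {n} → n ∈ u₀ ∪ u₁ → n ∈ u₁
    one (inj₁ n∈u₀) = contradiction n∈u₀ empty
    one (inj₂ n∈u₁) = n∈u₁

module _ {u₀ u₁ : Pred ℕ 0ℓ} (d : u₀ IsDisjointFrom u₁) (d′ : u₁ IsDisjointFrom u₀) where
  private
    module O = Oscillation u₀ u₁ d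
    module O′ = Oscillation u₁ u₀ d′

  ≃-swap : ∀ {n m} → n O.≃ m → n O′.≃ m
  ≃-swap (false , pm , pn , h) = true , pm , pn , h
  ≃-swap (true  , pm , pn , h) = false , pm , pn , h

module _ {u₀ u₁ : Pred ℕ 0ℓ} {d : u₀ IsDisjointFrom u₁} {d′ : u₁ IsDisjointFrom u₀} where

  -- Allows `HasOsc-suc` to extend the first set every time while the two points alternate, and
  -- makes the oscillation independent of the order of the leaves of a copy of `𝐀`.
  HasOsc-swap : ∀ {ℓ} → Oscillation.HasOsc u₀ u₁ d ℓ → Oscillation.HasOsc u₁ u₀ d′ ℓ
  HasOsc-swap B = record
    { to        = λ (n , s) → B.to (n , swap s)
    ; cong      = λ eq → B.cong (≃-swap d′ d eq)
    ; bijective = (λ eq → ≃-swap d d′ (B.injective eq))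
                , (λ i → let (n , s) , h = B.surjective i in
                         (n , swap s) , λ eq → h (≃-swap d′ d eq))
    }
    where module B = Bijection B

-- The elements of u₀′ beyond N form a new class: the element N of u₁ separates them from u₀.
module _ {u₀ u₁ u₀′ u₁′ : Pred ℕ 0ℓ} {d : u₀ IsDisjointFrom u₁} {d′ : u₀′ IsDisjointFrom u₁′}
         {N : ℕ} (u₀≤N : ∀ {n} → n ∈ u₀ → n ≤ N) (u₁≤N : ∀ {n} → n ∈ u₁ → n ≤ N) (N∈u₁ : N ∈ u₁)
         (u₀⊆u₀′ : u₀ ⊆ u₀′) (u₀′⊆u₀ : ∀ {n} → n ∈ u₀′ → n ≤ N → n ∈ u₀)
         (u₁⊆u₁′ : u₁ ⊆ u₁′) (u₁′⊆u₁ : u₁′ ⊆ u₁)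
         (new : ∃[ n ] n ∈ u₀′ × N < n) where
  private
    module O = Oscillation u₀ u₁ d
    module O′ = Oscillation u₀′ u₁′ d′

    bounded : ∀ i {n} → n ∈ O.u i → n ≤ N
    bounded false = u₀≤N
    bounded true  = u₁≤N

    extend : ∀ i {n} → n ∈ O.u i → n ∈ O′.u i
    extend false = u₀⊆u₀′
    extend true  = u₁⊆u₁′

    restrict : ∀ i {n} → n ≤ N → n ∈ O′.u i → n ∈ O.u i
    restrict false n≤N p = u₀′⊆u₀ p n≤N
    restrict true  n≤N p = u₁′⊆u₁ p

    side : ∀ {n} → n ∈ u₀′ ∪ u₁′ → ∃[ i ] n ∈ O′.u i
    side (inj₁ p) = false , p
    side (inj₂ p) = true , p

    unside : ∀ i {n} → n ∈ O.u i → n ∈ u₀ ∪ u₁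
    unside false = inj₁
    unside true  = inj₂

    old : ∀ {n} → n ∈ u₀′ ∪ u₁′ → n ≤ N → n ∈ u₀ ∪ u₁
    old s n≤N = let i , p = side s in unside i (restrict i n≤N p)

    beyond : ∀ {n} → n ∈ u₀′ ∪ u₁′ → ¬ (n ≤ N) → n ∈ u₀′
    beyond (inj₁ p) _   = p
    beyond (inj₂ p) n≰N = contradiction (u₁≤N (u₁′⊆u₁ p)) n≰N

    ≃-restrict : ∀ {n m} → n ≤ N → m ≤ N → n O′.≃ m → n O.≃ m
    ≃-restrict n≤N m≤N (i , pm , pn , h) =
      i , restrict i m≤N pm , restrict i n≤N pn , λ (k , pk , b) → h (k , extend (not i) pk , b)

    -- A separating `k` lies below one of two old elements, so it is at most `N` and was already
    -- there.
    ≃-extend : ∀ {n m} → n O.≃ m → n O′.≃ m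
    ≃-extend (i , pm , pn , h) = i , extend i pm , extend i pn , λ where
      (k , pk , inj₁ (n<k , k<m)) →
        h (k , restrict (not i) (ℕ.≤-trans (ℕ.<⇒≤ k<m) (bounded i pm)) pk , inj₁ (n<k , k<m))
      (k , pk , inj₂ (m<k , k<n)) →
        h (k , restrict (not i) (ℕ.≤-trans (ℕ.<⇒≤ k<n) (bounded i pn)) pk , inj₂ (m<k , k<n))

    separated : ∀ {n m} → n ≤ N → ¬ (m ≤ N) → ¬ (n O′.≃ m)
    separated n≤N m≰N (true  , pm , _ , _) = m≰N (u₁≤N (u₁′⊆u₁ pm))
    separated n≤N m≰N (false , _ , pn , h) =
      h (N , u₁⊆u₁′ N∈u₁ , inj₁ (ℕ.≤∧≢⇒< n≤N n≢N , ℕ.≰⇒> m≰N))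
      where
      -- To separate, `N` must lie strictly between; equality would put it into both `u₀` and `u₁`.
      n≢N : _ ≢ N
      n≢N refl = d (u₀′⊆u₀ pn ℕ.≤-refl , N∈u₁)

    -- A separating element would belong to `u₁′`, all of whose elements are at most `N`.
    ≃-beyond : ∀ {n m} → n ∈ u₀′ → m ∈ u₀′ → ¬ (n ≤ N) → ¬ (m ≤ N) → n O′.≃ m
    ≃-beyond pn pm n≰N m≰N = false , pm , pn , λ where
      (k , pk , inj₁ (n<k , _)) → n≰N (ℕ.≤-trans (ℕ.<⇒≤ n<k) (u₁≤N (u₁′⊆u₁ pk)))
      (k , pk , inj₂ (m<k , _)) → m≰N (ℕ.≤-trans (ℕ.<⇒≤ m<k) (u₁≤N (u₁′⊆u₁ pk)))

  HasOsc-suc : ∀ {ℓ} → O.HasOsc ℓ → O′.HasOsc (suc ℓ)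
  HasOsc-suc {ℓ} B = record
    { to        = class
    ; cong      = λ {x} {y} → class-cong x y
    ; bijective = (λ {x} {y} → class-injective x y) , class-surjective
    }
    where
    module B = Bijection B

    class : Σ ℕ (u₀′ ∪ u₁′) → Fin (suc ℓ)
    class (n , s) with n ≤? N
    ... | yes n≤N = inject₁ (B.to (n , old s n≤N))
    ... | no  _   = fromℕ ℓ

    class-cong : ∀ x y → proj₁ x O′.≃ proj₁ y → class x ≡ class y
    class-cong (n , s) (m , t) eq with n ≤? N | m ≤? N
    ... | yes n≤N | yes m≤N = cong inject₁ (B.cong (≃-restrict n≤N m≤N eq))
    ... | yes n≤N | no  m≰N = contradiction eq (separated n≤N m≰N)
    ... | no  n≰N | yes m≤N = contradiction (O′.≃-sym eq) (separated m≤N n≰N)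
    ... | no  _   | no  _   = refl

    class-injective : ∀ x y → class x ≡ class y → proj₁ x O′.≃ proj₁ y
    class-injective (n , s) (m , t) eq with n ≤? N | m ≤? N
    ... | yes n≤N | yes m≤N = ≃-extend (B.injective (inject₁-injective eq))
    ... | yes n≤N | no  m≰N = contradiction (sym eq) fromℕ≢inject₁
    ... | no  n≰N | yes m≤N = contradiction eq fromℕ≢inject₁
    ... | no  n≰N | no  m≰N = ≃-beyond (beyond s n≰N) (beyond t m≰N) n≰N m≰N

    -- Surjectivity between setoids asks for the value at everything equivalent to the witness;
    -- `class-cong` reduces this to the witness itself.
    class-hit : ∀ x {i} → class x ≡ i → ∃[ x ] (∀ {z} → proj₁ z O′.≃ proj₁ x → class z ≡ i)
    class-hit x eq = x , λ {z} h → trans (class-cong z x h) eq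

    class-old : ∀ n s → (s′ : n ∈ u₀′ ∪ u₁′) → n ≤ N → class (n , s′) ≡ inject₁ (B.to (n , s))
    class-old n s s′ n≤N with n ≤? N
    ... | yes _   = cong inject₁ (B.cong (O.≃-refl s))
    ... | no  n≰N = contradiction n≤N n≰N

    class-new : ∀ n s → N < n → class (n , s) ≡ fromℕ ℓ
    class-new n s N<n with n ≤? N
    ... | yes n≤N = contradiction n≤N (ℕ.<⇒≱ N<n)
    ... | no  _   = refl

    class-surjective : ∀ i → ∃[ x ] (∀ {z} → proj₁ z O′.≃ proj₁ x → class z ≡ i)
    class-surjective i with view i
    ... | ‵fromℕ     = let n , p , N<n = new in class-hit (n , inj₁ p) (class-new n _ N<n)
    ... | ‵inject₁ j with B.to⁻ j | Surjection.to∘to⁻ B.surjection j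
    ...   | n , inj₁ p | refl = class-hit (n , inj₁ (u₀⊆u₀′ p)) (class-old n (inj₁ p) _ (u₀≤N p))
    ...   | n , inj₂ p | refl = class-hit (n , inj₂ (u₁⊆u₁′ p)) (class-old n (inj₂ p) _ (u₁≤N p))

-- Pseudotrees

module Pseudotree {ψ : Structure} (isPseudotree : IsPseudotree ψ) where
  open Structure ψ using (_∧_) renaming (_≤_ to _⊑_) public
  open IsPseudotree isPseudotree public
  open IsPartialOrder isPartialOrder public
    using () renaming (refl to ⊑-refl; trans to ⊑-trans; antisym to ⊑-antisym)
  open Strict _≡_ _⊑_ public using () renaming (_<_ to _⊏_)

  ∧-lowerˡ : ∀ {a b} → a ∧ b ⊑ a
  ∧-lowerˡ = proj₂ (∧-sup _ _) proj₁

  ∧-lowerʳ : ∀ {a b} → a ∧ b ⊑ b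
  ∧-lowerʳ = proj₂ (∧-sup _ _) proj₂

  ∧-greatest : ∀ {a b x} → x ⊑ a → x ⊑ b → x ⊑ a ∧ b
  ∧-greatest x⊑a x⊑b = proj₁ (∧-sup _ _) (x⊑a , x⊑b)

  ⊏-trans : ∀ {x y z} → x ⊏ y → y ⊏ z → x ⊏ z
  ⊏-trans = Strict.<-trans _≡_ _⊑_ isPartialOrder

  ⊏⇒⋢ : ∀ {x y} → x ⊏ y → ¬ (y ⊑ x)
  ⊏⇒⋢ = Strict.<⇒≱ _≡_ _⊑_ ⊑-antisym

  -- Strictness leaves room around the branching node `y ∧ x`: it can serve as a new upper end over
  -- `a`, as a new lower end under `x`, or as the foot of a nontrivial path to `y`.
  record BranchesOff (a x y : Carrier ψ) : Set where
    field
      above : a ⊏ y ∧ x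
      below : y ∧ x ⊏ x
      off   : y ∧ x ⊏ y

  -- Axiomatises what the construction of oscillating pairs takes from a copy of the limit.
  record Branching (X : Pred (Carrier ψ) 0ℓ) : Set where
    field
      closed : Closed ψ X
      pair   : ∃₂ λ a x → a ∈ X × x ∈ X × a ⊏ x
      branch : ∀ {a x} → a ∈ X → x ∈ X → a ⊏ x → ∃[ y ] y ∈ X × BranchesOff a x y

-- `p` is a field pinned down by `p⇒` and `p⇐`, so that the `p` of an enumerating function fits in
-- unchanged and `HasOsˡ` unfolds to `HasOs`.
record Labelling (ψ : Structure) : Set₁ where
  open Structure ψ using () renaming (_≤_ to _⊑_)
  field
    r            : Carrier ψ → ℕ
    r-mono       : ∀ {a b} → a ⊑ b → r a ≤ r b
    r-comparable : ∀ {a b} → r a ≡ r b → a ⊑ b ⊎ b ⊑ a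
    p            : Carrier ψ → Pred ℕ 0ℓ
    p⇒           : ∀ {a n} → n ∈ p a → ∃[ z ] z ⊑ a × r z ≡ n
    p⇐           : ∀ {a z} → z ⊑ a → r z ∈ p a

  HasOsˡ : (a b : Carrier ψ) → ℕ → Set
  HasOsˡ a b = Oscillation.HasOsc (p a ∖ p b) (p b ∖ p a) (∖-disjoint (p a) (p b))

-- Oscillating pairs in a branching set

module _ {ψ : Structure} (lem : ExcludedMiddle 0ℓ) (isPseudotree : IsPseudotree ψ) (L : Labelling ψ) where
  open Pseudotree isPseudotree
  open Labelling L

  private variable
    a b x y : Carrier ψ
    m n : ℕ

  p-mono : a ⊑ b → p a ⊆ p b
  p-mono a⊑b n∈pa with p⇒ n∈pa
  ... | z , z⊑a , refl = p⇐ (⊑-trans z⊑a a⊑b)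

  r∈p : ∀ a → r a ∈ p a
  r∈p a = p⇐ ⊑-refl

  p≤r : n ∈ p a → n ≤ r a
  p≤r n∈pa with p⇒ n∈pa
  ... | z , z⊑a , refl = r-mono z⊑a

  -- The points below `a` and below `b` that carry the common label are comparable, and the smaller
  -- one lies below both `a` and `b`.
  p-∧ : n ∈ p a → n ∈ p b → n ∈ p (a ∧ b)
  p-∧ n∈pa n∈pb with p⇒ n∈pa | p⇒ n∈pb
  ... | z , z⊑a , refl | w , w⊑b , eq with r-comparable eq
  ...   | inj₁ w⊑z = subst (_∈ p _) eq (p⇐ (∧-greatest (⊑-trans w⊑z z⊑a) w⊑b))
  ...   | inj₂ z⊑w = p⇐ (∧-greatest z⊑a (⊑-trans z⊑w w⊑b))

  -- The point carrying the label is comparable with `a`, both being below `x`. It cannot lie below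
  -- `a`, so it lies above.
  new-label> : a ⊑ x → n ∈ p x → n ∉ p a → r a < n
  new-label> a⊑x n∈px n∉pa with p⇒ n∈px
  ... | z , z⊑x , refl with below-linear _ z⊑x a⊑x
  ...   | inj₁ z⊑a = contradiction (p⇐ z⊑a) n∉pa
  ...   | inj₂ a⊑z = ℕ.≤∧≢⇒< (r-mono a⊑z) λ eq → n∉pa (subst (_∈ p _) eq (r∈p _))

  -- A new label would exceed `r a`, but no label in `p x` exceeds `r x`.
  p-const : a ⊑ x → r a ≡ r x → p x ⊆ p a
  p-const {a} {x} a⊑x eq {n} n∈px with lem {n ∈ p a}
  ... | yes n∈pa = n∈pa
  ... | no  n∉pa = contradiction (p≤r n∈px) (ℕ.<⇒≱ (subst (_< n) eq (new-label> a⊑x n∈px n∉pa)))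

  module _ {X : Pred (Carrier ψ) 0ℓ} (branching : Branching X) where
    open Branching branching

    -- By `p-const` both ends have the same labels below them, so a branch leaving between them
    -- acquires the same new labels relative to `a` as relative to `x`.
    record Segment (a x : Carrier ψ) : Set where
      field
        a∈X      : a ∈ X
        x∈X      : x ∈ X
        a⊏x      : a ⊏ x
        constant : r a ≡ r x

    -- Descent on `r x`: a branching node strictly between `a` and `x` either has the label of `x`
    -- and forms a segment with it, or has a smaller label and replaces `x`.
    segment-below : a ∈ X → x ∈ X → a ⊏ x → ∃₂ λ b y → Segment b y × a ⊏ b × y ⊑ x
    segment-below {x = x} = go (<-wellFounded (r x))
      where
      go : ∀ {x} → Acc _<_ (r x) → a ∈ X → x ∈ X → a ⊏ x → ∃₂ λ b y → Segment b y × a ⊏ b × y ⊑ x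
      go {x = x} (acc rs) a∈X x∈X a⊏x with branch a∈X x∈X a⊏x
      ... | y , y∈X , record { above = a⊏w ; below = w⊏x } with r (y ∧ x) ℕ.≟ r x
      ...   | yes eq = y ∧ x , x , record { a∈X = closed y∈X x∈X ; x∈X = x∈X ; a⊏x = w⊏x ; constant = eq }
                     , a⊏w , ⊑-refl
      ...   | no neq with go (rs (ℕ.≤∧≢⇒< (r-mono (proj₁ w⊏x)) neq)) a∈X (closed y∈X x∈X) a⊏w
      ...     | b , y′ , seg , a⊏b , y′⊑w = b , y′ , seg , a⊏b , ⊑-trans y′⊑w (proj₁ w⊏x)

    -- Of two points branching off at different places, at most one acquires the label n.
    high-branch : ∀ n → a ∈ X → x ∈ X → a ⊏ x →
      ∃[ y ] y ∈ X × BranchesOff a x y × (∀ {m} → m ∈ p y → m ∉ p x → n ≤ m)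
    high-branch zero a∈X x∈X a⊏x with branch a∈X x∈X a⊏x
    ... | y , y∈X , off = y , y∈X , off , λ _ _ → z≤n
    high-branch {a} {x} (suc n) a∈X x∈X a⊏x with branch a∈X x∈X a⊏x
    ... | v , v∈X , record { above = a⊏w ; below = w⊏x } = choose
      where
      w = v ∧ x
      w∈X : w ∈ X
      w∈X = closed v∈X x∈X

      module _ {y} (y∈X : y ∈ X) (y-off : BranchesOff w x y) where
        open BranchesOff y-off

        other : n ∈ p y → n ∉ p x →
          ∃[ z ] z ∈ X × BranchesOff a w z × (∀ {m} → m ∈ p z → m ∉ p w → n ≤ m) →
          ∃[ z ] z ∈ X × BranchesOff a x z × (∀ {m} → m ∈ p z → m ∉ p x → suc n ≤ m)
        other n∈py n∉px (z , z∈X , z-off , high) = z , z∈X , z-off-x , λ {m} m∈pz m∉px →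
            -- If `z` also had the label `n`, then `n` would be a label below `z ∧ y`, hence below
            -- `x`.
            ℕ.≤∧≢⇒< (high m∈pz (m∉px ∘ p-mono (proj₁ w⊏x)))
                    (λ { refl → n∉px (p-mono z∧y⊑x (p-∧ m∈pz n∈py)) })
          where
          module Z = BranchesOff z-off
          -- Since `z` leaves the path to `x` before `w` is reached, its meets with `y` and with `x`
          -- both fall below `w`.
          w⋢z : ¬ (w ⊑ z)
          w⋢z w⊑z = ⊏⇒⋢ Z.below (∧-greatest w⊑z ⊑-refl)

          z∧y⊑x : z ∧ y ⊑ x
          z∧y⊑x with below-linear y ∧-lowerʳ (⊑-trans (proj₁ above) ∧-lowerˡ)
          ... | inj₁ z∧y⊑w = ⊑-trans z∧y⊑w (proj₁ w⊏x)
          ... | inj₂ w⊑z∧y = contradiction (⊑-trans w⊑z∧y ∧-lowerˡ) w⋢z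

          z∧x≡z∧w : z ∧ x ≡ z ∧ w
          z∧x≡z∧w with below-linear x (∧-lowerʳ {z}) (proj₁ w⊏x)
          ... | inj₁ z∧x⊑w = ⊑-antisym (∧-greatest ∧-lowerˡ z∧x⊑w)
                                       (∧-greatest ∧-lowerˡ (⊑-trans ∧-lowerʳ (proj₁ w⊏x)))
          ... | inj₂ w⊑z∧x = contradiction (⊑-trans w⊑z∧x ∧-lowerˡ) w⋢z

          z-off-x : BranchesOff a x z
          z-off-x = record
            { above = subst (a ⊏_) (sym z∧x≡z∧w) Z.above
            ; below = subst (_⊏ x) (sym z∧x≡z∧w) (⊏-trans Z.below w⊏x)
            ; off   = subst (_⊏ z) (sym z∧x≡z∧w) Z.off
            }

      choose : ∃[ y ] y ∈ X × BranchesOff a x y × (∀ {m} → m ∈ p y → m ∉ p x → suc n ≤ m)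
      -- First try a branch leaving between `w` and `x`. If it acquires `n`, a branch leaving
      -- between `a` and `w` does not.
      choose with high-branch n w∈X x∈X w⊏x
      ... | y , y∈X , y-off , high with lem {n ∈ p y × n ∉ p x}
      ...   | yes (n∈py , n∉px) = other y∈X y-off n∈py n∉px (high-branch n a∈X w∈X a⊏w)
      ...   | no  ¬n = y , y∈X , record { above = ⊏-trans a⊏w above ; below = below ; off = off }
                     , λ m∈py m∉px → ℕ.≤∧≢⇒< (high m∈py m∉px) λ { refl → ¬n (m∈py , m∉px) }
        where open BranchesOff y-off

    -- Leave the segment along a high branch `y` and take a new segment above the branching node.
    -- Its lower end `b` lies below `y` but strictly above `y ∧ x`, which makes it incomparable with
    -- `x`.
    climb : ∀ n → Segment a x → ∃₂ λ b y → Segment b y × a ⊏ b × Incomparable ψ x b × r a < r b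
                                         × (∀ {m} → m ∈ p b → m ∉ p a → n ≤ m)
    climb {a} {x} n seg with high-branch n a∈X x∈X a⊏x
      where open Segment seg
    ... | y , y∈X , y-off , high with segment-below (closed y∈X (Segment.x∈X seg)) y∈X (BranchesOff.off y-off)
    ...   | b , y′ , seg′ , w⊏b , y′⊑y =
            b , y′ , seg′ , ⊏-trans above w⊏b , (x⋢b , b⋢x)
          , ℕ.≤∧≢⇒< (r-mono (proj₁ (⊏-trans above w⊏b))) ra≢rb
          , λ m∈pb m∉pa → high (p-mono b⊑y m∈pb) (m∉pa ∘ p-const (proj₁ a⊏x) constant)
      where
      open Segment seg
      open BranchesOff y-off
      b⊑y : b ⊑ y
      b⊑y = ⊑-trans (proj₁ (Segment.a⊏x seg′)) y′⊑y
      x⋢b : ¬ (x ⊑ b)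
      x⋢b x⊑b = ⊏⇒⋢ below (∧-greatest (⊑-trans x⊑b b⊑y) ⊑-refl)
      b⋢x : ¬ (b ⊑ x)
      b⋢x b⊑x = ⊏⇒⋢ w⊏b (∧-greatest b⊑y b⊑x)
      -- As `r a` equals `r x`, equal labels would make `x` and `b` comparable.
      ra≢rb : r a ≢ r b
      ra≢rb eq with r-comparable (trans (sym constant) eq)
      ... | inj₁ x⊑b = x⋢b x⊑b
      ... | inj₂ b⊑x = b⋢x b⊑x

    -- The invariant of the alternation. By `r<r`, the label `r a₂` is the greatest in the symmetric
    -- difference of `p a₁` and `p a₂` and belongs to the second side: it is the `N` of
    -- `HasOsc-suc`. The segments allow further climbing.
    record Oscillating (ℓ : ℕ) : Set where
      field
        {a₁ x₁ a₂ x₂} : Carrier ψ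
        segment₁      : Segment a₁ x₁
        segment₂      : Segment a₂ x₂
        incomparable  : Incomparable ψ a₁ a₂
        r<r           : r a₁ < r a₂
        hasOs         : HasOsˡ a₁ a₂ ℓ

    -- A segment is split at a branching node `w`. Climbing from the lower half gives `b` above `a`
    -- and incomparable with `w`; since `p w` equals `p a`, only `b` has labels of its own. The
    -- upper half is kept as the segment of `w`.
    oscillating-one : Oscillating 1
    oscillating-one with pair
    ... | u , v , u∈X , v∈X , u⊏v with segment-below u∈X v∈X u⊏v
    ...   | a , x , seg , _ with branch a∈X x∈X a⊏x
      where open Segment seg
    ...     | z , z∈X , record { above = a⊏w ; below = w⊏x } = go (climb 0 lower)
      where
      open Segment seg
      w = z ∧ x
      w∈X : w ∈ X
      w∈X = closed z∈X x∈X
      ra≡rw : r a ≡ r w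
      ra≡rw = ℕ.≤-antisym (r-mono (proj₁ a⊏w)) (ℕ.≤-trans (r-mono (proj₁ w⊏x)) (ℕ.≤-reflexive (sym constant)))

      lower : Segment a w
      lower = record { a∈X = a∈X ; x∈X = w∈X ; a⊏x = a⊏w ; constant = ra≡rw }

      upper : Segment w x
      upper = record { a∈X = w∈X ; x∈X = x∈X ; a⊏x = w⊏x ; constant = trans (sym ra≡rw) constant }

      go : (∃₂ λ b y → Segment b y × a ⊏ b × Incomparable ψ w b × r a < r b
                     × (∀ {m} → m ∈ p b → m ∉ p a → 0 ≤ m)) → Oscillating 1
      go (b , y , seg′ , a⊏b , incomp , ra<rb , _) = record
        { segment₁     = upper
        ; segment₂     = seg′
        ; incomparable = incomp
        ; r<r          = rw<rb
        ; hasOs        = HasOsc-one (∖-disjoint (p w) (p b))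
            (λ (n∈pw , n∉pb) → n∉pb (p-mono (proj₁ a⊏b) (p-const (proj₁ a⊏w) ra≡rw n∈pw)))
            (r b , r∈p b , ℕ.<⇒≱ rw<rb ∘ p≤r)
        }
        where
        rw<rb : r w < r b
        rw<rb = subst (_< r b) ra≡rw ra<rb

    -- The point with the smaller label is moved up past the label of the other. It then has the
    -- greater label, so the two exchange places.
    oscillating-suc : ∀ {ℓ} → Oscillating ℓ → Oscillating (suc ℓ)
    oscillating-suc record { a₁ = a ; a₂ = b ; segment₁ = seg₁ ; segment₂ = seg₂
                           ; incomparable = a⋢b , b⋢a ; r<r = ra<rb ; hasOs = os }
      -- The `suc` puts every new label strictly beyond `r b`, the last label of the current
      -- oscillation.
      with climb (suc (r b)) seg₁
    ... | a′ , x′ , seg′ , a⊏a′ , _ , ra<ra′ , high = record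
      { segment₁     = seg₂
      ; segment₂     = seg′
      -- If `b` were below `a′`, linearity below `a′` would make `a` and `b` comparable.
      ; incomparable = (λ b⊑a′ → ⊎-contra (below-linear a′ b⊑a′ a⊑a′)) , (λ a′⊑b → a⋢b (⊑-trans a⊑a′ a′⊑b))
      ; r<r          = rb<ra′
      ; hasOs        = HasOsc-swap (HasOsc-suc {d = ∖-disjoint (p a) (p b)} {∖-disjoint (p a′) (p b)}
          (λ (n∈pa , _) → ℕ.≤-trans (p≤r n∈pa) (ℕ.<⇒≤ ra<rb))
          (λ (n∈pb , _) → p≤r n∈pb)
          (r∈p b , ℕ.<⇒≱ ra<rb ∘ p≤r)
          (λ (n∈pa , n∉pb) → p-mono a⊑a′ n∈pa , n∉pb)
          (λ (n∈pa′ , n∉pb) n≤rb → old n∈pa′ n≤rb , n∉pb)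
          (λ (n∈pb , n∉pa) → n∈pb , λ n∈pa′ → n∉pa (old n∈pa′ (p≤r n∈pb)))
          (λ (n∈pb , n∉pa′) → n∈pb , n∉pa′ ∘ p-mono a⊑a′)
          (r a′ , (r∈p a′ , ℕ.<⇒≱ rb<ra′ ∘ p≤r) , rb<ra′)
          os)
      }
      where
      a⊑a′ = proj₁ a⊏a′

      ⊎-contra : ¬ (b ⊑ a ⊎ a ⊑ b)
      ⊎-contra (inj₁ b⊑a) = b⋢a b⊑a
      ⊎-contra (inj₂ a⊑b) = a⋢b a⊑b

      rb<ra′ : r b < r a′
      rb<ra′ = high (r∈p a′) (ℕ.<⇒≱ ra<ra′ ∘ p≤r)

      old : ∀ {n} → n ∈ p a′ → n ≤ r b → n ∈ p a
      old n∈pa′ n≤rb = decidable-stable lem λ n∉pa → ℕ.<⇒≱ (high n∈pa′ n∉pa) n≤rb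

    oscillating : ∀ ℓ → 1 ≤ ℓ → Oscillating ℓ
    oscillating (suc zero)    _ = oscillating-one
    oscillating (suc (suc ℓ)) _ = oscillating-suc (oscillating (suc ℓ) (s≤s z≤n))

    every-oscillation : ∀ ℓ → 1 ≤ ℓ →
      ∃₂ λ a b → a ∈ X × b ∈ X × Incomparable ψ a b × HasOsˡ a b ℓ
    every-oscillation ℓ 1≤ℓ = a₁ , a₂ , Segment.a∈X segment₁ , Segment.a∈X segment₂ , incomparable , hasOs
      where open Oscillating (oscillating ℓ 1≤ℓ)

-- Fraïssé limits

_∘↪_ : ∀ {A B C} → B ↪ C → A ↪ B → A ↪ C
k ∘↪ h = record
  { to        = K.to ∘ H.to
  ; injective = H.injective ∘ K.injective
  ; ≤-iff     = mk⇔ (Equivalence.to K.≤-iff ∘ Equivalence.to H.≤-iff)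
                    (Equivalence.from H.≤-iff ∘ Equivalence.from K.≤-iff)
  ; ∧-hom     = λ x y → trans (cong K.to (H.∧-hom x y)) (K.∧-hom _ _)
  }
  where
  module K = _↪_ k
  module H = _↪_ h

module Substructure (lem : ExcludedMiddle 0ℓ) (M : Structure) {n : ℕ} (g : Fin n → Carrier M) where
  open Structure M using (_∧_) renaming (_≤_ to _⊑_)

  -- Membership is squashed, so that elements of ⟨g⟩ are equal as soon as they are equal in M.
  ⟨g⟩ : Structure
  ⟨g⟩ = record
    { Carrier = Σ[ x ∈ Carrier M ] True (lem {Generated M g x})
    ; _≤_     = λ x y → proj₁ x ⊑ proj₁ y
    ; _∧_     = λ x y → proj₁ x ∧ proj₁ y , fromWitness (meet (toWitness (proj₂ x)) (toWitness (proj₂ y)))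
    }

  generator : Fin n → Carrier ⟨g⟩
  generator i = g i , fromWitness (gen i)

  proj₁-injective : ∀ {x y : Carrier ⟨g⟩} → proj₁ x ≡ proj₁ y → x ≡ y
  proj₁-injective refl = cong (_ ,_) (T-irrelevant _ _)

  finitelyGenerated : FinitelyGenerated ⟨g⟩
  finitelyGenerated = n , generator , λ x → lift (toWitness (proj₂ x)) (proj₂ x)
    where
    -- Stated for every squashed proof `t`, as the one produced by `gen` or `meet` need not be the
    -- given one syntactically; `proj₁-injective` identifies them.
    lift : ∀ {x} → Generated M g x → ∀ t → Generated ⟨g⟩ generator (x , t)
    lift (gen i)    t = subst (Generated ⟨g⟩ generator) (proj₁-injective refl) (gen i)
    lift (meet p q) t = subst (Generated ⟨g⟩ generator) (proj₁-injective refl)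
                          (meet (lift p (fromWitness p)) (lift q (fromWitness q)))

  inclusion : ⟨g⟩ ↪ M
  inclusion = record
    { to        = proj₁
    ; injective = proj₁-injective
    ; ≤-iff     = mk⇔ id id
    ; ∧-hom     = λ _ _ → refl
    }

-- Small finite trees

meetOrder : ∀ {A : Set} → (A → A → A) → Structure
meetOrder {A} _∧_ = record { Carrier = A ; _≤_ = λ x y → x ∧ y ≡ x ; _∧_ = _∧_ }

module _ {ψ : Structure} (isPseudotree : IsPseudotree ψ) where
  open Pseudotree isPseudotree

  ⊑⇒∧≡ : ∀ {x y} → x ⊑ y → x ∧ y ≡ x
  ⊑⇒∧≡ x⊑y = ⊑-antisym ∧-lowerˡ (∧-greatest ⊑-refl x⊑y)

  ⊑⇒∧≡′ : ∀ {x y} → x ⊑ y → y ∧ x ≡ x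
  ⊑⇒∧≡′ x⊑y = ⊑-antisym ∧-lowerʳ (∧-greatest x⊑y ⊑-refl)

  -- On both sides the order can be read off from the meet, so an injective map preserving meets
  -- also preserves and reflects the order.
  meetEmbedding : ∀ {A : Set} {_∙_ : A → A → A} (h : A → Carrier ψ) →
    (∀ {x y} → h x ≡ h y → x ≡ y) → (∀ x y → h (x ∙ y) ≡ h x ∧ h y) → meetOrder _∙_ ↪ ψ
  meetEmbedding h injective hom = record
    { to        = h
    ; injective = injective
    ; ≤-iff     = λ {x} {y} → mk⇔
        (λ eq → subst (_⊑ h y) (trans (sym (hom x y)) (cong h eq)) ∧-lowerʳ)
        (λ hx⊑hy → injective (trans (hom x y) (⊑⇒∧≡ hx⊑hy)))
    ; ∧-hom     = hom
    }

_∧²_ : Fin 2 → Fin 2 → Fin 2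
0F ∧² _ = 0F
1F ∧² y = y

𝟐 : Structure
𝟐 = meetOrder _∧²_

𝟐-finitelyGenerated : FinitelyGenerated 𝟐
𝟐-finitelyGenerated = 2 , id , gen

-- The tree 0 < 1 < 2 , 3 with 2 and 3 incomparable.
_∧⁴_ : Fin 4 → Fin 4 → Fin 4
0F ∧⁴ _  = 0F
_  ∧⁴ 0F = 0F
2F ∧⁴ 2F = 2F
3F ∧⁴ 3F = 3F
_  ∧⁴ _  = 1F

𝟒 : Structure
𝟒 = meetOrder _∧⁴_

_≤⁴?_ : ∀ x y → Dec (x ∧⁴ y ≡ x)
x ≤⁴? y = (x ∧⁴ y) Fin.≟ x

-- The axioms quantify over four elements and are settled by exhaustive decision.
𝟒-pseudotree : FinitePseudotree 𝟒
𝟒-pseudotree = (4 , ↔-id _) , record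
  { isPartialOrder = record
    { isPreorder = record
      { isEquivalence = isEquivalence
      ; reflexive     = λ { {x} refl → from-yes (all? λ x → x ≤⁴? x) x }
      ; trans         = λ {x} {y} {z} →
          from-yes (all? λ x → all? λ y → all? λ z → x ≤⁴? y →-dec (y ≤⁴? z →-dec x ≤⁴? z)) x y z
      }
    ; antisym = λ {x} {y} →
        from-yes (all? λ x → all? λ y → x ≤⁴? y →-dec (y ≤⁴? x →-dec x Fin.≟ y)) x y
    }
  ; ∧-sup = λ a b →
        (λ {x} (x≤a , x≤b) → from-yes (all? λ a → all? λ b → all? λ x →
            x ≤⁴? a →-dec (x ≤⁴? b →-dec x ≤⁴? (a ∧⁴ b))) a b x x≤a x≤b)
      -- The meet is itself a common lower bound, so every upper bound of the common lower bounds is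
      -- above it.
      , (λ upper → upper (from-yes (all? λ a → all? λ b →
            (a ∧⁴ b) ≤⁴? a ×-dec (a ∧⁴ b) ≤⁴? b) a b))
  ; below-linear = λ a {x} {y} →
      from-yes (all? λ a → all? λ x → all? λ y → x ≤⁴? a →-dec (y ≤⁴? a →-dec (x ≤⁴? y ⊎-dec y ≤⁴? x))) a x y
  }

𝟒-binary : IsBinary 𝟒
𝟒-binary = from-yes (all? λ a → all? λ x → all? λ y → all? λ z →
  a <⁴? x →-dec (a <⁴? y →-dec (a <⁴? z →-dec
    ¬? (a Fin.≟ x ∧⁴ y ×-dec (a Fin.≟ x ∧⁴ z ×-dec a Fin.≟ y ∧⁴ z)))))
  where
  _<⁴?_ : ∀ a x → Dec (_<ₜ_ 𝟒 a x)
  a <⁴? x = a ≤⁴? x ×-dec ¬? (a Fin.≟ x)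

-- The top goes to a leaf, so that the node `1F`, where the other leaf branches off, lies strictly
-- between the two images.
𝟐↪𝟒 : 𝟐 ↪ 𝟒
𝟐↪𝟒 = meetEmbedding (proj₂ 𝟒-pseudotree) (λ { 0F → 0F ; 1F → 2F })
  (λ { {0F} {0F} _ → refl ; {0F} {1F} () ; {1F} {0F} () ; {1F} {1F} _ → refl })
  (λ { 0F 0F → refl ; 0F 1F → refl ; 1F 0F → refl ; 1F 1F → refl })

-- Pseudotree axioms and branching in the limit

module Limit (lem : ExcludedMiddle 0ℓ) {K : Pred Structure 0ℓ}
             (K⇒pseudotree : ∀ {A} → A ∈ K → IsPseudotree A) (𝟒∈K : 𝟒 ∈ K)
             {ψ : Structure} (limit : IsFraïsséLimit K ψ) where
  open IsFraïsséLimit limit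
  open Structure ψ using (_∧_) renaming (_≤_ to _⊑_)

  module _ (a b c : Carrier ψ) where
    private
      g : Fin 3 → Carrier ψ
      g 0F = a
      g 1F = b
      g 2F = c
    open Substructure lem ψ g

    -- The age puts this substructure into `K`. Each pseudotree axiom can be tested on at most three
    -- elements, so the axioms pass from such substructures to `ψ`.
    generated-pseudotree : IsPseudotree ⟨g⟩
    generated-pseudotree = K⇒pseudotree (Equivalence.from (age ⟨g⟩) (finitelyGenerated , inclusion))

    open Pseudotree generated-pseudotree
      using (⊑-refl; ⊑-trans; ⊑-antisym; below-linear; ∧-lowerˡ; ∧-lowerʳ; ∧-greatest)

    limit-trans : a ⊑ b → b ⊑ c → a ⊑ c
    limit-trans a⊑b b⊑c = ⊑-trans {generator 0F} {generator 1F} {generator 2F} a⊑b b⊑c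

    limit-antisym : a ⊑ b → b ⊑ a → a ≡ b
    limit-antisym a⊑b b⊑a = cong proj₁ (⊑-antisym {generator 0F} {generator 1F} a⊑b b⊑a)

    limit-linear : b ⊑ a → c ⊑ a → b ⊑ c ⊎ c ⊑ b
    limit-linear b⊑a c⊑a = below-linear (generator 0F) {generator 1F} {generator 2F} b⊑a c⊑a

    limit-refl : a ⊑ a
    limit-refl = ⊑-refl {generator 0F}

    limit-lower : a ∧ b ⊑ a × a ∧ b ⊑ b
    limit-lower = ∧-lowerˡ {generator 0F} {generator 1F} , ∧-lowerʳ {generator 0F} {generator 1F}

    limit-greatest : c ⊑ a → c ⊑ b → c ⊑ a ∧ b
    limit-greatest = ∧-greatest {generator 0F} {generator 1F} {generator 2F}

  isPseudotree : IsPseudotree ψ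
  isPseudotree = record
    { isPartialOrder = record
      { isPreorder = record
        { isEquivalence = isEquivalence
        ; reflexive     = λ { {x} refl → limit-refl x x x }
        ; trans         = λ {x} {y} {z} → limit-trans x y z
        }
      ; antisym = λ {x} {y} → limit-antisym x y y
      }
    ; ∧-sup        = λ a b → (λ {x} (x⊑a , x⊑b) → limit-greatest a b x x⊑a x⊑b)
                           , (λ upper → upper (limit-lower a b b))
    ; below-linear = λ a {x} {y} → limit-linear a x y
    }

  open Pseudotree isPseudotree using (_⊏_; ⊑-refl; BranchesOff; Branching)

  𝟒↪ψ : 𝟒 ↪ ψ
  𝟒↪ψ = proj₂ (Equivalence.to (age 𝟒) 𝟒∈K)

  chain : ∀ {u v} → u ⊏ v → 𝟐 ↪ ψ
  chain {u} {v} (u⊑v , u≢v) = meetEmbedding isPseudotree (λ { 0F → u ; 1F → v })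
    (λ { {0F} {0F} _ → refl ; {0F} {1F} eq → contradiction eq u≢v
       ; {1F} {0F} eq → contradiction (sym eq) u≢v ; {1F} {1F} _ → refl })
    (λ { 0F 0F → sym (⊑⇒∧≡ isPseudotree ⊑-refl) ; 0F 1F → sym (⊑⇒∧≡ isPseudotree u⊑v)
       ; 1F 0F → sym (⊑⇒∧≡′ isPseudotree u⊑v) ; 1F 1F → sym (⊑⇒∧≡ isPseudotree ⊑-refl) })

  module _ (h : 𝟒 ↪ ψ) where
    open _↪_ h

    edge : ∀ {x y} → x ∧⁴ y ≡ x → x ≢ y → to x ⊏ to y
    edge x≤y x≢y = Equivalence.to ≤-iff x≤y , x≢y ∘ injective

    𝟒-branchesOff : BranchesOff (to 0F) (to 2F) (to 3F)
    𝟒-branchesOff = record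
      { above = subst (to 0F ⊏_) (∧-hom 3F 2F) (edge refl λ ())
      ; below = subst (_⊏ to 2F) (∧-hom 3F 2F) (edge refl λ ())
      ; off   = subst (_⊏ to 3F) (∧-hom 3F 2F) (edge refl λ ())
      }

  -- Homogeneity moves the image of the chain `0F`, `2F` of `𝟒` onto `u`, `v`; the image of the leaf
  -- `3F` moves along and branches off.
  branch-at : ∀ {u v} → u ⊏ v → ∃[ y ] BranchesOff u v y
  branch-at u⊏v with homogeneous 𝟐 𝟐-finitelyGenerated (𝟒↪ψ ∘↪ 𝟐↪𝟒) (chain u⊏v)
  ... | (α , _) , agree with agree 0F | agree 1F
  ...   | refl | refl = _ , 𝟒-branchesOff (α ∘↪ 𝟒↪ψ)

  copy-branching : (φ : Copy ψ ψ) → Branching (Copy.subset φ)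
  copy-branching φ = record
    { closed = Copy.closed φ
    ; pair   = _ , _ , image _ , image _ , image-⊏ (edge 𝟒↪ψ {0F} {1F} refl λ ())
    ; branch = branch
    }
    where
    open _↪_ (proj₁ (Copy.iso φ))

    image : ∀ x → to x ∈ Copy.subset φ
    image x = Equivalence.from (proj₂ (Copy.iso φ) (to x)) (x , refl)

    image-⊏ : ∀ {x y} → x ⊏ y → to x ⊏ to y
    image-⊏ (x⊑y , x≢y) = Equivalence.to ≤-iff x⊑y , x≢y ∘ injective

    branch : ∀ {a x} → a ∈ Copy.subset φ → x ∈ Copy.subset φ → a ⊏ x →
             ∃[ y ] y ∈ Copy.subset φ × BranchesOff a x y
    branch {a} {x} a∈φ x∈φ (a⊑x , a≢x)
      with Equivalence.to (proj₂ (Copy.iso φ) a) a∈φ | Equivalence.to (proj₂ (Copy.iso φ) x) x∈φ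
    ... | u , refl | v , refl with branch-at (Equivalence.from ≤-iff a⊑x , a≢x ∘ cong to)
    ...   | y , off = to y , image y , record
        { above = subst (to u ⊏_) (∧-hom y v) (image-⊏ above)
        ; below = subst (_⊏ to v) (∧-hom y v) (image-⊏ below)
        ; off   = subst (_⊏ to y) (∧-hom y v) (image-⊏ leave)
        }
      where open BranchesOff off renaming (off to leave)

-- Labellings

module _ {ψ : Structure} (lem : ExcludedMiddle 0ℓ) (isPseudotree : IsPseudotree ψ) where
  open Pseudotree isPseudotree

  ray-linear : (R : Ray ψ) → Linear ψ (Ray.points R)
  ray-linear R with Ray.isRay R
  ... | inj₁ (_ , (linear , _) , _) = linear
  ... | inj₂ (_ , linear , _)       = linear

  -- A member of the chain either lies below `b`, like `a`, or lies above `b` and hence above `a`.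
  add-linear : ∀ {R a b} → Linear ψ R → b ∈ R → a ⊑ b → Linear ψ (λ x → x ∈ R ⊎ x ≡ a)
  add-linear {R} {a} {b} linear b∈R a⊑b = both
    where
    with-a : ∀ {x} → x ∈ R → x ⊑ a ⊎ a ⊑ x
    with-a x∈R with linear x∈R b∈R
    ... | inj₁ x⊑b = below-linear b x⊑b a⊑b
    ... | inj₂ b⊑x = inj₂ (⊑-trans a⊑b b⊑x)

    both : Linear ψ (λ x → x ∈ R ⊎ x ≡ a)
    both (inj₁ x∈R)  (inj₁ y∈R)  = linear x∈R y∈R
    both (inj₁ x∈R)  (inj₂ refl) = with-a x∈R
    both (inj₂ refl) (inj₁ y∈R)  = swap (with-a y∈R)
    both (inj₂ refl) (inj₂ refl) = inj₁ ⊑-refl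

  -- Adding `a` to the ray keeps it linear and, if there is an origin and `a` is not below it, keeps
  -- that origin as infimum. Maximality then puts `a` into the ray.
  below-ray : (R : Ray ψ) → ∀ {a b} → b ∈ Ray.points R → a ⊑ b →
    a ∈ Ray.points R ⊎ ∃[ o ] IsInf ψ (Ray.points R) o × a ⊑ o
  below-ray R {a} {b} b∈R a⊑b with Ray.isRay R
  ... | inj₂ (_ , linear , maximal) =
    inj₁ (maximal _ (add-linear linear b∈R a⊑b) inj₁ (inj₂ refl))
  ... | inj₁ (o , (linear , (lower , greatest) , o∉R) , maximal) with lem {a ⊑ o}
  ...   | yes a⊑o = inj₂ (o , (lower , greatest) , a⊑o)
  ...   | no  a⋢o = inj₁ (maximal _ (add-linear linear b∈R a⊑b , inf , o∉) inj₁ (inj₂ refl))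
    where
    o⊑a : o ⊑ a
    o⊑a with below-linear b a⊑b (lower b∈R)
    ... | inj₁ a⊑o = contradiction a⊑o a⋢o
    ... | inj₂ o⊑a = o⊑a

    inf : IsInf ψ (λ x → x ∈ Ray.points R ⊎ x ≡ a) o
    inf = (λ { (inj₁ x∈R) → lower x∈R ; (inj₂ refl) → o⊑a }) , λ l → greatest (l ∘ inj₁)

    o∉ : ¬ (o ∈ Ray.points R ⊎ o ≡ a)
    o∉ (inj₁ o∈R)  = o∉R o∈R
    o∉ (inj₂ refl) = a⋢o ⊑-refl

  module _ (F : EnumeratingFunction ψ) where
    open EnumeratingFunction F
    open Ray using (points)

    private
      ray-of : ∀ x → ∃[ m ] m < proj₁ (covers x) × (Σ[ R ∈ Ray ψ ] f m ≡ inj₂ R × x ∈ points R)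
      ray-of x = point-on-ray (proj₂ (covers x))

    index : Carrier ψ → ℕ
    index x = proj₁ (ray-of x)

    -- Enumerated rays with different numbers are disjoint.
    index-unique : ∀ {m R x} → f m ≡ inj₂ R → x ∈ points R → index x ≡ m
    index-unique {m} {x = x} fm x∈R with ray-of x
    ... | n , _ , S , fn , x∈S with n ℕ.≟ m
    ...   | yes eq  = eq
    ...   | no  neq = contradiction (x∈S , x∈R) (disjoint neq fn fm)

    -- The ray of `o` precedes the position of `o` given by `covers`, and injectivity of `f`
    -- identifies that position with `m`.
    index-before : ∀ {n o} → o ∈ PointsBefore n → index o < n
    index-before {o = o} (m , m<n , fm) =
      ℕ.<-trans (subst (index o <_) covers≡m (proj₁ (proj₂ (ray-of o)))) m<n
      where
      same : Pointwise _≡_ (_≐_ on points) (f (proj₁ (covers o))) (f m)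
      same rewrite proj₂ (covers o) | fm = inj₁ refl

      covers≡m : proj₁ (covers o) ≡ m
      covers≡m = one-to-one same

    -- Induction on the index of `b`: if `a` is not on the ray of `b`, it lies below the origin of
    -- that ray, and the origin has a smaller index, being enumerated before the ray.
    index-mono : ∀ {a b} → a ⊑ b → index a ≤ index b
    index-mono = go (<-wellFounded _)
      where
      go : ∀ {a b} → Acc _<_ (index b) → a ⊑ b → index a ≤ index b
      go {a} {b} (acc rs) a⊑b with ray-of b
      ... | n , _ , R , fn , b∈R with below-ray R b∈R a⊑b
      ...   | inj₁ a∈R             = ℕ.≤-reflexive (index-unique fn a∈R)
      ...   | inj₂ (o , inf , a⊑o) = ℕ.≤-trans (go (rs o<n) a⊑o) (ℕ.<⇒≤ o<n)
        where o<n = index-before (ray-origin fn inf)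

    index-comparable : ∀ {a b} → index a ≡ index b → a ⊑ b ⊎ b ⊑ a
    index-comparable {a} {b} eq with ray-of a | ray-of b
    index-comparable refl | _ , _ , R , fm , a∈R | _ , _ , S , fn , b∈S with trans (sym fm) fn
    ... | refl = ray-linear R a∈R b∈S

    index∈p : ∀ {a z} → z ⊑ a → index z ∈ p a
    index∈p {a} {z} z⊑a with ray-of z
    ... | n , _ , R , fn , z∈R with f n | fn
    ...   | _ | refl = z , z∈R , z⊑a

    p⇒index : ∀ {a n} → n ∈ p a → ∃[ z ] z ⊑ a × index z ≡ n
    p⇒index {a} {n} n∈pa with f n in fn
    p⇒index (z , z∈R , z⊑a) | inj₂ R = z , z⊑a , index-unique fn z∈R

    rayLabelling : Labelling ψ
    rayLabelling = record
      { r            = index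
      ; r-mono       = index-mono
      ; r-comparable = index-comparable
      ; p            = p
      ; p⇒           = λ {a} {n} → p⇒index {a} {n}
      ; p⇐           = index∈p
      }

  codeLabelling : Carrier ψ ↣ ℕ → Labelling ψ
  codeLabelling code = record
    { r            = r
    ; r-mono       = r-mono
    ; r-comparable = r-comparable
    ; p            = λ a n → ∃[ z ] z ⊑ a × r z ≡ n
    ; p⇒           = id
    ; p⇐           = λ z⊑a → _ , z⊑a , refl
    }
    where
    open Injection code using (to; injective)

    code-above : ∀ a → ∃[ m ] (∃[ x ] a ⊑ x × to x ≡ m) × (∀ {k} → (∃[ x ] a ⊑ x × to x ≡ k) → m ≤ k)
    code-above a = least lem _ (a , ⊑-refl , refl)

    r : Carrier ψ → ℕ
    r a = proj₁ (code-above a)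

    r-mono : ∀ {a b} → a ⊑ b → r a ≤ r b
    r-mono {a} {b} a⊑b with code-above b
    ... | _ , (x , b⊑x , eq) , _ = proj₂ (proj₂ (code-above a)) (x , ⊑-trans a⊑b b⊑x , eq)

    -- Equal least codes are attained at one and the same point, and `a` and `b` both lie below it.
    r-comparable : ∀ {a b} → r a ≡ r b → a ⊑ b ⊎ b ⊑ a
    r-comparable {a} {b} eq with code-above a | code-above b
    r-comparable {a} {b} refl | _ , (x , a⊑x , ex) , _ | _ , (y , b⊑y , ey) , _
      with injective (trans ex (sym ey))
    ... | refl = below-linear x a⊑x b⊑y

  -- The colour of a copy of 𝐀 with leaves a and b is os(a , b) − 1 if this is at most ℓ, and 0 otherwise.
  module Colouring (L : Labelling ψ) (ℓ : ℕ) where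
    open Labelling L

    leaves-os : Copy ψ 𝐀 → ℕ → Set
    leaves-os X = HasOsˡ (to left) (to right)
      where open _↪_ (proj₁ (Copy.iso X))

    leaves-os-resp : ∀ {k} (X Y : Copy ψ 𝐀) → Copy.subset X ≐ Copy.subset Y → leaves-os X k → leaves-os Y k
    leaves-os-resp {k} X Y (X⊆Y , _) = go (in-Y left) (in-Y right)
      where
      module X = _↪_ (proj₁ (Copy.iso X))
      module Y = _↪_ (proj₁ (Copy.iso Y))

      in-Y : ∀ v → ∃[ w ] Y.to w ≡ X.to v
      in-Y v = Equivalence.to (proj₂ (Copy.iso Y) (X.to v))
                 (X⊆Y (Equivalence.from (proj₂ (Copy.iso X) (X.to v)) (v , refl)))

      reflect : ∀ {v w v′ w′} → v ≤ⱽ w → Y.to v ≡ X.to v′ → Y.to w ≡ X.to w′ → v′ ≤ⱽ w′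
      reflect v≤w eq eq′ = Equivalence.from X.≤-iff
        (subst (_ ⊑_) eq′ (subst (_⊑ _) eq (Equivalence.to Y.≤-iff v≤w)))

      go : ∃[ v ] Y.to v ≡ X.to left → ∃[ w ] Y.to w ≡ X.to right → leaves-os X k → leaves-os Y k
      -- If the root of `Y` were a leaf of `X`, that leaf would lie below the other one.
      go (root , eq)  (w , eq′)     _  = contradiction (reflect root≤ eq eq′) λ ()
      go (v , eq)     (root , eq′)  _  = contradiction (reflect root≤ eq′ eq) λ ()
      go (left , eq)  (left , eq′)  _  = contradiction (reflect ≤refl eq eq′) λ ()
      go (right , eq) (right , eq′) _  = contradiction (reflect ≤refl eq eq′) λ ()
      go (left , eq)  (right , eq′) os = subst₂ (λ a b → HasOsˡ a b k) (sym eq) (sym eq′) os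
      go (right , eq) (left , eq′)  os =
        HasOsc-swap (subst₂ (λ a b → HasOsˡ a b k) (sym eq) (sym eq′) os)

    leaves-os-unique : ∀ {k l} (X : Copy ψ 𝐀) → leaves-os X k → leaves-os X l → k ≡ l
    leaves-os-unique X = HasOsc-unique (∖-disjoint (p (to left)) (p (to right)))
      where open _↪_ (proj₁ (Copy.iso X))

    colour : Copy ψ 𝐀 → Fin (suc ℓ)
    colour X with lem {∃[ i ] leaves-os X (suc (toℕ {suc ℓ} i))}
    ... | yes (i , _) = i
    ... | no  _       = 0F

    colour-unique : ∀ X i → leaves-os X (suc (toℕ i)) → colour X ≡ i
    colour-unique X i os with lem {∃[ i ] leaves-os X (suc (toℕ {suc ℓ} i))}
    ... | yes (j , os′) = Fin.toℕ-injective (ℕ.suc-injective (leaves-os-unique X os′ os))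
    ... | no  none      = contradiction (i , os) none

    colour-cong : ∀ {X Y} → Copy.subset X ≐ Copy.subset Y → colour X ≡ colour Y
    colour-cong {X} {Y} X≐Y@(X⊆Y , Y⊆X)
      with lem {∃[ i ] leaves-os X (suc (toℕ {suc ℓ} i))} | lem {∃[ i ] leaves-os Y (suc (toℕ {suc ℓ} i))}
    ... | yes (i , os) | yes (j , os′) =
          Fin.toℕ-injective (ℕ.suc-injective (leaves-os-unique Y (leaves-os-resp X Y X≐Y os) os′))
    ... | yes (i , os) | no none       = contradiction (i , leaves-os-resp X Y X≐Y os) none
    ... | no none      | yes (j , os)  = contradiction (j , leaves-os-resp Y X (Y⊆X , X⊆Y) os) none
    ... | no _         | no _          = refl

    colouring : Func (Binom ψ 𝐀) (setoid (Fin (suc ℓ)))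
    colouring = record { to = colour ; cong = λ {X} {Y} → colour-cong {X} {Y} }

  -- Copies of `𝐀` spanned by incomparable points

  module _ {a b : Carrier ψ} (incomparable : Incomparable ψ a b) where
    private
      a⋢b = proj₁ incomparable
      b⋢a = proj₂ incomparable

    point : V → Carrier ψ
    point root  = a ∧ b
    point left  = a
    point right = b

    𝐀↪ψ : 𝐀 ↪ ψ
    𝐀↪ψ = record
      { to        = point
      ; injective = λ eq → ≤ⱽ-antisym (reflects (⊑-reflexive eq)) (reflects (⊑-reflexive (sym eq)))
      ; ≤-iff     = mk⇔ preserves reflects
      ; ∧-hom     = hom
      }
      where
      ⊑-reflexive : ∀ {x y} → x ≡ y → x ⊑ y
      ⊑-reflexive refl = ⊑-refl

      ≤ⱽ-antisym : ∀ {v w} → v ≤ⱽ w → w ≤ⱽ v → v ≡ w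
      ≤ⱽ-antisym root≤ root≤ = refl
      ≤ⱽ-antisym root≤ ≤refl = refl
      ≤ⱽ-antisym ≤refl _     = refl

      preserves : ∀ {v w} → v ≤ⱽ w → point v ⊑ point w
      preserves ≤refl                 = ⊑-refl
      preserves {w = root}  root≤ = ⊑-refl
      preserves {w = left}  root≤ = ∧-lowerˡ
      preserves {w = right} root≤ = ∧-lowerʳ

      reflects : ∀ {v w} → point v ⊑ point w → v ≤ⱽ w
      reflects {root}          _   = root≤
      reflects {left}  {left}  _   = ≤refl
      reflects {right} {right} _   = ≤refl
      reflects {left}  {right} a⊑b = contradiction a⊑b a⋢b
      reflects {right} {left}  b⊑a = contradiction b⊑a b⋢a
      -- A leaf below the meet would lie below the other leaf.
      reflects {left}  {root}  a⊑r = contradiction (⊑-trans a⊑r ∧-lowerʳ) a⋢b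
      reflects {right} {root}  b⊑r = contradiction (⊑-trans b⊑r ∧-lowerˡ) b⋢a

      hom : ∀ v w → point (v ∧ⱽ w) ≡ point v ∧ point w
      hom root  w     = sym (⊑⇒∧≡ isPseudotree (preserves {root} {w} root≤))
      hom left  root  = sym (⊑⇒∧≡′ isPseudotree ∧-lowerˡ)
      hom right root  = sym (⊑⇒∧≡′ isPseudotree ∧-lowerʳ)
      hom left  left  = sym (⊑⇒∧≡ isPseudotree ⊑-refl)
      hom right right = sym (⊑⇒∧≡ isPseudotree ⊑-refl)
      hom left  right = refl
      hom right left  = ⊑-antisym (∧-greatest ∧-lowerʳ ∧-lowerˡ) (∧-greatest ∧-lowerʳ ∧-lowerˡ)

    spanned : Copy ψ 𝐀
    spanned = record
      { subset = λ x → ∃[ v ] point v ≡ x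
      ; closed = λ { (v , refl) (w , refl) → v ∧ⱽ w , _↪_.∧-hom 𝐀↪ψ v w }
      ; iso    = 𝐀↪ψ , λ _ → mk⇔ id id
      }

    spanned-⊆ : {X : Pred (Carrier ψ) 0ℓ} → Closed ψ X → a ∈ X → b ∈ X → Copy.subset spanned ⊆ X
    spanned-⊆ closed a∈X b∈X (root  , refl) = closed a∈X b∈X
    spanned-⊆ closed a∈X b∈X (left  , refl) = a∈X
    spanned-⊆ closed a∈X b∈X (right , refl) = b∈X

-- Oscillations in copies and the big Ramsey degree

module _ (lem : ExcludedMiddle 0ℓ) {K : Pred Structure 0ℓ}
         (K⇒pseudotree : ∀ {A} → A ∈ K → IsPseudotree A) (𝟒∈K : 𝟒 ∈ K)
         {ψ : Structure} (limit : IsFraïsséLimit K ψ) where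
  open Limit lem K⇒pseudotree 𝟒∈K limit

  oscillations-in-copy : (L : Labelling ψ) (φ : Copy ψ ψ) (ℓ : ℕ) → 1 ≤ ℓ →
    ∃₂ λ a b → a ∈ Copy.subset φ × b ∈ Copy.subset φ × Incomparable ψ a b × Labelling.HasOsˡ L a b ℓ
  oscillations-in-copy L φ = every-oscillation lem isPseudotree L (copy-branching φ)

  -- Every copy of `ψ` realises all oscillations from 1 to `suc ℓ`, so the colouring by oscillation
  -- omits no colour on it.
  degree-∞ : BigRamseyDegree ψ 𝐀 ∞
  degree-∞ ℓ arrows = let C , omits = arrows colouring in omits λ i →
    let a , b , a∈C , b∈C , incomparable , os = oscillations-in-copy L C (suc (toℕ i)) (s≤s z≤n)
        X = spanned lem isPseudotree incomparable
    in X , spanned-⊆ lem isPseudotree incomparable (Copy.closed C) a∈C b∈C , colour-unique X i os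
    where
    L = codeLabelling lem isPseudotree (IsFraïsséLimit.countable limit)
    open Colouring lem isPseudotree L ℓ

theorem10 : (∀ {a} → ExcludedMiddle a) →
    (ψ : Structure) →
    IsFraïsséLimit FinitePseudotree ψ ⊎ IsFraïsséLimit FiniteBinaryPseudotree ψ →
    ((f : EnumeratingFunction ψ) (φ : Copy ψ ψ) (ℓ : ℕ) → 1 ≤ ℓ →
    ∃₂ λ a b → a ∈ Copy.subset φ × b ∈ Copy.subset φ ×
    Incomparable ψ a b × HasOs f a b ℓ)
    × BigRamseyDegree ψ 𝐀 ∞
-- The two cases differ only in why members of the class are pseudotrees and why `𝟒` is among them.
theorem10 lem ψ (inj₁ limit) =
  (λ F → oscillations-in-copy lem proj₂ 𝟒-pseudotree limit
           (rayLabelling lem (Limit.isPseudotree lem proj₂ 𝟒-pseudotree limit) F))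
  , degree-∞ lem proj₂ 𝟒-pseudotree limit
theorem10 lem ψ (inj₂ limit) =
  (λ F → oscillations-in-copy lem (proj₂ ∘ proj₁) (𝟒-pseudotree , 𝟒-binary) limit
           (rayLabelling lem (Limit.isPseudotree lem (proj₂ ∘ proj₁) (𝟒-pseudotree , 𝟒-binary) limit) F))
  , degree-∞ lem (proj₂ ∘ proj₁) (𝟒-pseudotree , 𝟒-binary) limit
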